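{- A boolean combination of conditional formulas (formulas $A\mathrel{|\!\sim}B$ with $A,B$ propositional) is satisfiable in a cumulative model $\mathcal{M}=\langle S,\mathcal{W},l,<,V\rangle$ if and only if it is satisfiable in a C-preferential model $\mathcal{M}'=\langle\mathcal{W}',R,<',V'\rangle$.
   Context: Propositional formulas ($A,B,\dots$) are built from a set $\mathit{ATM}$ of propositional variables with the boolean connectives. **Cumulative model** $\mathcal{M}=\langle S,\mathcal{W},l,<,V\rangle$: $S$ is a set of states; $\mathcal{W}$ a set of possible worlds; $l:S\to\mathrm{pow}(\mathcal{W})$ labels every state with a non-empty set of worlds; $<$ is an irreflexive (not necessarily transitive) relation on $S$; $V:\mathcal{W}\to\mathrm{pow}(\mathit{ATM})$ gives the atoms true at each world. For $A$ propositional and $s\in S$, $\mathcal{M},s\mid\!\equiv A$ iff $\mathcal{M},w\models A$ (classical evaluation at $w$ via $V$) for all $w\in l(s)$. $Min_<(A)$ is the set of states $s$ such that $\mathcal{M},s\mid\!\equiv A$ and no $s'<s$ has $\mathcal{M},s'\mid\!\equiv A$. $\mathcal{M},s\mid\!\equiv A\mathrel{|\!\sim}B$ iff $\mathcal{M},s'\mid\!\equiv B$ for all $s'\in Min_<(A)$; $\mid\!\equiv$ extends to boolean combinations of conditionals in the standard (classical) way. Smoothness condition (part of the definition): for every propositional $A$ and state $s$, if $\mathcal{M},s\mid\!\equiv A$ then $s\in Min_<(A)$ or there is $s'\in Min_<(A)$ with $s'<s$. A boolean combination of conditionals is satisfiable in $\mathcal{M}$ if it holds ($\mid\!\equiv$)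 at some state. **C-preferential model** $\mathcal{M}=\langle\mathcal{W},R,<,V\rangle$: $\mathcal{W}$ is a non-empty set of worlds; $R$ is a serial relation on $\mathcal{W}$; $<$ is an irreflexive (not necessarily transitive) relation on $\mathcal{W}$; $V:\mathcal{W}\to\mathrm{pow}(\mathit{ATM})$. Boolean combinations are evaluated classically at worlds. For $A$ propositional, $\mathcal{M},w\models LA$ iff $\mathcal{M},w'\models A$ for all $w'$ with $wRw'$. $Min_<(LA)=\{w\mid\mathcal{M},w\models LA$ and for all $w'<w$, $\mathcal{M},w'\not\models LA\}$. $\mathcal{M},w\models A\mathrel{|\!\sim}B$ iff $\mathcal{M},w'\models LB$ for all $w'\in Min_<(LA)$. Smoothness condition for $L$-formulas (part of the definition): for every propositional $A$ and world $w$, if $\mathcal{M},w\models LA$ then $w\in Min_<(LA)$ or there is $w'\in Min_<(LA)$ with $w'<w$. A formula is satisfiable in $\mathcal{M}$ if it is true at some world. -}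

module Defs where

open import Data.Bool.Base using (Bool; false; not; _∧_; _∨_; T)
open import Data.Empty.Polymorphic using (⊥)
open import Data.Product.Base using (∃; _×_)
open import Data.Sum.Base using (_⊎_)
open import Level using (Level; _⊔_; suc)
open import Relation.Binary.Core using (Rel)
open import Relation.Binary.Definitions using (Irreflexive)
open import Relation.Binary.PropositionalEquality.Core using (_≡_)
open import Relation.Nullary.Negation.Core using (¬_)
open import Relation.Unary using (Pred; _∈_; Satisfiable)

private
  variable
    a x ℓ : Level

infix  8 ¬'_
infixr 7 _∧'_
infixr 6 _∨'_
infixr 5 _⇒'_
infix  4 _|~_

data BoolComb (X : Set x) : Set x where
  var            : X → BoolComb X
  ⊥'             : BoolComb X
  ¬'_            : BoolComb X → BoolComb X
  _∧'_ _∨'_ _⇒'_ : BoolComb X → BoolComb X → BoolComb X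

PropFormula : Set a → Set a
PropFormula ATM = BoolComb ATM

record Conditional (ATM : Set a) : Set a where
  constructor _|~_
  field
    antecedent consequent : PropFormula ATM

CondFormula : Set a → Set a
CondFormula ATM = BoolComb (Conditional ATM)

truthValue : {X : Set x} → (X → Bool) → BoolComb X → Bool
truthValue v (var p)  = v p
truthValue v ⊥'       = false
truthValue v (¬' A)   = not (truthValue v A)
truthValue v (A ∧' B) = truthValue v A ∧ truthValue v B
truthValue v (A ∨' B) = truthValue v A ∨ truthValue v B
truthValue v (A ⇒' B) = not (truthValue v A) ∨ truthValue v B

-- Conditionals quantify over states or worlds, so their truth is a type rather
-- than a Bool.  The atoms used below are stable under double negation; reading
-- disjunction as ¬ (¬ P × ¬ Q) then makes every formula stable, so that all
-- classical propositional laws hold of this evaluation.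
Holds : {X : Set x} → (X → Set ℓ) → BoolComb X → Set ℓ
Holds h (var c)  = h c
Holds h ⊥'       = ⊥
Holds h (¬' φ)   = ¬ Holds h φ
Holds h (φ ∧' ψ) = Holds h φ × Holds h ψ
Holds h (φ ∨' ψ) = ¬ (¬ Holds h φ × ¬ Holds h ψ)
Holds h (φ ⇒' ψ) = Holds h φ → Holds h ψ

Min : {S : Set ℓ} → Rel S ℓ → Pred S ℓ → Pred S ℓ
Min _<_ P s = P s × (∀ s' → s' < s → ¬ P s')

Smooth : {S : Set ℓ} → Rel S ℓ → Pred S ℓ → Set ℓ
Smooth _<_ P = ∀ s → P s → s ∈ Min _<_ P ⊎ ∃ λ s' → s' ∈ Min _<_ P × s' < s

-- Subsets of ATM are given by characteristic functions into Bool, so that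
-- propositional formulas are evaluated by classical truth tables.
Valuation : Set ℓ → Set a → Set (ℓ ⊔ a)
Valuation W ATM = W → ATM → Bool

_⊨[_]_ : {W : Set ℓ} {ATM : Set a} → W → Valuation W ATM → PropFormula ATM → Set
w ⊨[ V ] A = T (truthValue (V w) A)

record CumulativeModel (ATM : Set a) (ℓ : Level) : Set (a ⊔ suc ℓ) where
  field
    S     : Set ℓ
    W     : Set ℓ
    l     : S → Pred W ℓ
    _<_   : Rel S ℓ
    V     : Valuation W ATM

  infix 4 _|≡_ _|≡ᶜ_ _|≡ᵇ_

  _|≡_ : S → PropFormula ATM → Set ℓ
  s |≡ A = ∀ w → w ∈ l s → w ⊨[ V ] A

  field
    l-nonempty : ∀ s → Satisfiable (l s)
    <-irrefl   : Irreflexive _≡_ _<_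
    smooth     : ∀ A → Smooth _<_ (_|≡ A)

  _|≡ᶜ_ : S → Conditional ATM → Set ℓ
  s |≡ᶜ (A |~ B) = ∀ s' → s' ∈ Min _<_ (_|≡ A) → s' |≡ B

  _|≡ᵇ_ : S → CondFormula ATM → Set ℓ
  s |≡ᵇ φ = Holds (s |≡ᶜ_) φ

record CPreferentialModel (ATM : Set a) (ℓ : Level) : Set (a ⊔ suc ℓ) where
  field
    W     : Set ℓ
    R     : Rel W ℓ
    _<_   : Rel W ℓ
    V     : Valuation W ATM

  infix 4 _⊨L_ _⊨ᶜ_ _⊨ᵇ_

  _⊨L_ : W → PropFormula ATM → Set ℓ
  w ⊨L A = ∀ w' → R w w' → w' ⊨[ V ] A

  field
    W-nonempty : W
    R-serial   : ∀ w → ∃ λ w' → R w w'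
    <-irrefl   : Irreflexive _≡_ _<_
    smooth     : ∀ A → Smooth _<_ (_⊨L A)

  _⊨ᶜ_ : W → Conditional ATM → Set ℓ
  w ⊨ᶜ (A |~ B) = ∀ w' → w' ∈ Min _<_ (_⊨L A) → w' ⊨L B

  _⊨ᵇ_ : W → CondFormula ATM → Set ℓ
  w ⊨ᵇ φ = Holds (w ⊨ᶜ_) φ

SatisfiableInCumulative : {ATM : Set a} → CumulativeModel ATM ℓ → CondFormula ATM → Set ℓ
SatisfiableInCumulative M φ = ∃ λ s → s |≡ᵇ φ
  where open CumulativeModel M

SatisfiableInCPreferential : {ATM : Set a} → CPreferentialModel ATM ℓ → CondFormula ATM → Set ℓ
SatisfiableInCPreferential M φ = ∃ λ w → w ⊨ᵇ φ
  where open CPreferentialModel M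

{-# OPTIONS --safe #-}
module Submission where

-- A state that labels a set of worlds and a world that sees a set of worlds
-- carry the same information, once states are turned into worlds.
--
-- From a C-preferential model, take the worlds themselves as states and label
-- w with its R-successors; seriality says that the labels are non-empty, and
-- "w ⊨ L A" is then literally "w |≡ A".
--
-- From a cumulative model, take as worlds the pairs (s , w) with w in l(s).
-- Let (s , w) see exactly the pairs over the same state s, compare pairs by
-- their states, and evaluate atoms at w.  Then (s , w) ⊨ L A iff s |≡ A
-- (⊨L⇔|≡).  As every label is non-empty, every state has a pair over it, so
-- minimality (Min⇔Min), and with it smoothness and the truth of conditionals
-- (⊨ᶜ⇔|≡ᶜ), transfers between pairs and states.  Boolean combinations follow
-- because their truth depends only on that of their atoms (Holds-cong).

open import Data.Product.Base using (∃; _,_; proj₁; proj₂)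
open import Data.Product.Function.NonDependent.Propositional using (_×-⇔_)
open import Data.Sum.Base using (inj₁; inj₂)
open import Function.Base using (_on_)
open import Function.Bundles using (_⇔_; mk⇔; module Equivalence)
open import Function.Construct.Identity using (⇔-id)
open import Function.Related.TypeIsomorphisms using (→-cong-⇔; ¬-cong-⇔)
open import Level using (Level)
open import Relation.Binary.PropositionalEquality.Core using (_≡_; refl; cong)
open import Relation.Unary using (_∈_)
open import Defs

open Equivalence using (to; from)

private
  variable
    a x ℓ : Level

Holds-cong : {X : Set x} {h k : X → Set ℓ} → (∀ c → h c ⇔ k c) →
             ∀ φ → Holds h φ ⇔ Holds k φ
Holds-cong e (var c)  = e c
Holds-cong e ⊥'       = ⇔-id _
Holds-cong e (¬' φ)   = ¬-cong-⇔ (Holds-cong e φ)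
Holds-cong e (φ ∧' ψ) = Holds-cong e φ ×-⇔ Holds-cong e ψ
Holds-cong e (φ ∨' ψ) =
  ¬-cong-⇔ (¬-cong-⇔ (Holds-cong e φ) ×-⇔ ¬-cong-⇔ (Holds-cong e ψ))
Holds-cong e (φ ⇒' ψ) = →-cong-⇔ (Holds-cong e φ) (Holds-cong e ψ)

-- The cumulative model whose states are the worlds of a C-preferential model,
-- each labelled with the set of its R-successors.
toCumulative : {ATM : Set a} → CPreferentialModel ATM ℓ → CumulativeModel ATM ℓ
toCumulative M = record
  { S          = W
  ; W          = W
  ; l          = R
  ; _<_        = _<_
  ; V          = V
  ; l-nonempty = R-serial
  ; <-irrefl   = <-irrefl
  ; smooth     = smooth
  }
  where open CPreferentialModel M

module PointedStates {ATM : Set a} (M : CumulativeModel ATM ℓ) where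
  open CumulativeModel M

  -- States with a chosen world of their label: the worlds of the
  -- C-preferential model built from M.
  PointedState : Set ℓ
  PointedState = ∃ λ s → ∃ λ w → w ∈ l s

  state : PointedState → S
  state = proj₁

  -- Some pointed state over a given state.  Since state (point s) reduces to s,
  -- quantifying over pointed states amounts to quantifying over states.
  point : S → PointedState
  point s = s , l-nonempty s

  _≺_ : PointedState → PointedState → Set ℓ
  _≺_ = _<_ on state

  valuation : Valuation PointedState ATM
  valuation (_ , w , _) = V w

  -- Accessibility is "having the same state".
  _⊨L_ : PointedState → PropFormula ATM → Set ℓ
  p ⊨L A = ∀ q → state p ≡ state q → q ⊨[ valuation ] A

  ⊨L⇔|≡ : ∀ A p → p ⊨L A ⇔ state p |≡ A
  ⊨L⇔|≡ A (s , _) = mk⇔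
    (λ pA w w∈ls → pA (s , w , w∈ls) refl)
    (λ { sA (_ , w , w∈ls) refl → sA w w∈ls })

  Min⇔Min : ∀ A p → p ∈ Min _≺_ (_⊨L A) ⇔ state p ∈ Min _<_ (_|≡ A)
  Min⇔Min A p = mk⇔
    (λ (pA , min) → to (⊨L⇔|≡ A p) pA ,
      λ s' s'<s s'A → min (point s') s'<s (from (⊨L⇔|≡ A (point s')) s'A))
    (λ (sA , min) → from (⊨L⇔|≡ A p) sA ,
      λ q q≺p qA → min (state q) q≺p (to (⊨L⇔|≡ A q) qA))

  ≺-smooth : ∀ A → Smooth _≺_ (_⊨L A)
  ≺-smooth A p pA with smooth A (state p) (to (⊨L⇔|≡ A p) pA)
  ... | inj₁ s∈Min                 = inj₁ (from (Min⇔Min A p) s∈Min)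
  ... | inj₂ (s' , s'∈Min , s'<s) =
    inj₂ (point s' , from (Min⇔Min A (point s')) s'∈Min , s'<s)

  -- The C-preferential model on the pointed states of M.  Its worlds must be
  -- non-empty while M may have no states, so a state of M is supplied.
  toCPreferential : S → CPreferentialModel ATM ℓ
  toCPreferential s₀ = record
    { W          = PointedState
    ; R          = _≡_ on state
    ; _<_        = _≺_
    ; V          = valuation
    ; W-nonempty = point s₀
    ; R-serial   = λ p → p , refl
    ; <-irrefl   = λ p≡q → <-irrefl (cong state p≡q)
    ; smooth     = ≺-smooth
    }

  module _ (s₀ : S) where
    open CPreferentialModel (toCPreferential s₀) using (_⊨ᶜ_)

    ⊨ᶜ⇔|≡ᶜ : ∀ p c → (p ⊨ᶜ c) ⇔ (state p |≡ᶜ c)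
    ⊨ᶜ⇔|≡ᶜ p (A |~ B) = mk⇔
      (λ h s s∈Min →
        to (⊨L⇔|≡ B (point s)) (h (point s) (from (Min⇔Min A (point s)) s∈Min)))
      (λ h q q∈Min → from (⊨L⇔|≡ B q) (h (state q) (to (Min⇔Min A q) q∈Min)))

open PointedStates

proposition2p14 : {a : Level} (ℓ : Level) (ATM : Set a) (φ : CondFormula ATM) →
    (∃ λ (M : CumulativeModel ATM ℓ) → SatisfiableInCumulative M φ)
    ⇔ (∃ λ (M' : CPreferentialModel ATM ℓ) → SatisfiableInCPreferential M' φ)
proposition2p14 ℓ ATM φ = mk⇔
  (λ (M , s , sφ) →
    toCPreferential M s , point M s ,
      from (Holds-cong (⊨ᶜ⇔|≡ᶜ M s (point M s)) φ) sφ)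
  -- The satisfaction relations of M' and toCumulative M' agree on atoms
  -- definitionally, so the satisfying world and its proof carry over unchanged.
  (λ (M' , w , wφ) → toCumulative M' , w , wφ)
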